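{- For every integer $t\ge 3$, there exist two triplets of non $\epsilon$-cospectral $\epsilon$-equienergetic graphs on $6+12t$ vertices.
   Context: All graphs are finite, simple, undirected and connected. For a connected graph $G$ with distance function $d$, the eccentricity of a vertex $v$ is $e(v)=\max\{d(v,u):u\in V(G)\}$. The eccentricity matrix $\epsilon(G)$ is the symmetric matrix indexed by $V(G)$ with $(u,v)$ entry $d(u,v)$ if $d(u,v)=\min\{e(u),e(v)\}$, and $0$ otherwise. The $\epsilon$-spectrum of $G$ is the multiset of eigenvalues of $\epsilon(G)$, and the $\epsilon$-energy is the sum of the absolute values of these eigenvalues (with multiplicity). Two non-isomorphic graphs of the same order are $\epsilon$-cospectral if they have the same $\epsilon$-spectrum, and non $\epsilon$-cospectral otherwise. Two graphs of the same order are $\epsilon$-equienergetic if they have the same $\epsilon$-energy. "Two triplets" means two different (unordered) triplets of graphs up to isomorphism, each triplet consisting of three graphs that are pairwise non $\epsilon$-cospectral and pairwise $\epsilon$-equienergetic. -}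

module Defs where

open import Data.Bool.Base using (if_then_else_)
open import Data.Fin.Base using (Fin; zero; suc; punchIn)
open import Data.Fin.Permutation using (Permutation′; _⟨$⟩ʳ_)
open import Data.Fin.Properties using (any?) renaming (_≟_ to _≟ᶠ_)
open import Data.Integer.Base using (+_)
open import Data.Nat.Base as ℕ using (ℕ; zero; suc; z≤n; s≤s)
import Data.Nat.Properties as ℕₚ
open import Data.Product.Base using (Σ-syntax; ∃-syntax; _×_; _,_; proj₁; proj₂)
open import Data.Rational as ℚ using (ℚ; 0ℚ; 1ℚ; ½)
import Data.Rational.Properties as ℚₚ
open import Data.Rational.Solver using (module +-*-Solver)
open import Data.Sum.Base using (inj₁; inj₂)
open import Data.Vec.Functional using (Vector; foldr)
open import Function.Base using (_∘_)
open import Function.Bundles using (_⇔_)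
open import Level using (0ℓ)
open import Relation.Binary.Core using (Rel)
open import Relation.Binary.Definitions using (Decidable; Symmetric; Irreflexive)
open import Relation.Binary.PropositionalEquality
open import Relation.Nullary using (¬_; Dec; yes; no; does; contradiction; map′)
open import Relation.Nullary.Decidable using (_×-dec_)
import Relation.Unary as U

------------------------------------------------------------------------
-- Real numbers: Cauchy sequences of rationals, with pointwise operations,
-- up to the equality "the difference tends to 0".

IsCauchy : (ℕ → ℚ) → Set
IsCauchy x = ∀ δ → 0ℚ ℚ.< δ →
  ∃[ N ] (∀ m n → N ℕ.≤ m → N ℕ.≤ n → ℚ.∣ x m ℚ.- x n ∣ ℚ.< δ)

record ℝ : Set where
  constructor mkℝ
  field
    seq    : ℕ → ℚ
    cauchy : IsCauchy seq

open ℝ public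

infix 4 _≈_

_≈_ : Rel ℝ 0ℓ
x ≈ y = ∀ δ → 0ℚ ℚ.< δ →
  ∃[ N ] (∀ n → N ℕ.≤ n → ℚ.∣ seq x n ℚ.- seq y n ∣ ℚ.< δ)

module CauchyLemmas where

  open +-*-Solver

  abstract

    half>0 : ∀ {δ} → 0ℚ ℚ.< δ → 0ℚ ℚ.< ½ ℚ.* δ
    half>0 {δ} δ>0 = subst (ℚ._< ½ ℚ.* δ) (ℚₚ.*-zeroʳ ½) (ℚₚ.*-monoʳ-<-pos ½ δ>0)

    half+half : ∀ δ → ½ ℚ.* δ ℚ.+ ½ ℚ.* δ ≡ δ
    half+half δ = trans (sym (ℚₚ.*-distribʳ-+ δ ½ ½)) (ℚₚ.*-identityˡ δ)

    +-difference : ∀ a b c d → (a ℚ.+ b) ℚ.- (c ℚ.+ d) ≡ (a ℚ.- c) ℚ.+ (b ℚ.- d)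
    +-difference = solve 4
      (λ a b c d → (a :+ b) :- (c :+ d) := (a :- c) :+ (b :- d)) refl

    *-difference : ∀ a b c d → (a ℚ.* b) ℚ.- (c ℚ.* d) ≡ a ℚ.* (b ℚ.- d) ℚ.+ d ℚ.* (a ℚ.- c)
    *-difference = solve 4
      (λ a b c d → (a :* b) :- (c :* d) := a :* (b :- d) :+ d :* (a :- c)) refl

    neg-difference : ∀ a b → ℚ.- a ℚ.- ℚ.- b ≡ ℚ.- (a ℚ.- b)
    neg-difference = solve 2 (λ a b → (:- a) :- (:- b) := :- (a :- b)) refl

    sub-add : ∀ a b → (a ℚ.- b) ℚ.+ b ≡ a
    sub-add = solve 2 (λ a b → (a :- b) :+ b := a) refl

    add-sub : ∀ a b → (a ℚ.+ b) ℚ.- b ≡ a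
    add-sub = solve 2 (λ a b → (a :+ b) :- b := a) refl

    neg-sub : ∀ a b → ℚ.- (a ℚ.- b) ≡ b ℚ.- a
    neg-sub = solve 2 (λ a b → :- (a :- b) := b :- a) refl

    ∣a∣≤∣a-b∣+∣b∣ : ∀ a b → ℚ.∣ a ∣ ℚ.≤ ℚ.∣ a ℚ.- b ∣ ℚ.+ ℚ.∣ b ∣
    ∣a∣≤∣a-b∣+∣b∣ a b = subst (λ z → ℚ.∣ z ∣ ℚ.≤ ℚ.∣ a ℚ.- b ∣ ℚ.+ ℚ.∣ b ∣)
      (sub-add a b) (ℚₚ.∣p+q∣≤∣p∣+∣q∣ (a ℚ.- b) b)

    ∣a-b∣-comm : ∀ a b → ℚ.∣ a ℚ.- b ∣ ≡ ℚ.∣ b ℚ.- a ∣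
    ∣a-b∣-comm a b =
      trans (sym (ℚₚ.∣-p∣≡∣p∣ (a ℚ.- b))) (cong ℚ.∣_∣ (neg-sub a b))

    ∣a∣-∣b∣≤∣a-b∣ : ∀ a b → ℚ.∣ a ∣ ℚ.- ℚ.∣ b ∣ ℚ.≤ ℚ.∣ a ℚ.- b ∣
    ∣a∣-∣b∣≤∣a-b∣ a b = subst (ℚ.∣ a ∣ ℚ.- ℚ.∣ b ∣ ℚ.≤_)
      (add-sub ℚ.∣ a ℚ.- b ∣ ℚ.∣ b ∣)
      (ℚₚ.+-monoˡ-≤ (ℚ.- ℚ.∣ b ∣) (∣a∣≤∣a-b∣+∣b∣ a b))

    ∣∣a∣-∣b∣∣≤∣a-b∣ : ∀ a b → ℚ.∣ ℚ.∣ a ∣ ℚ.- ℚ.∣ b ∣ ∣ ℚ.≤ ℚ.∣ a ℚ.- b ∣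
    ∣∣a∣-∣b∣∣≤∣a-b∣ a b with ℚₚ.∣p∣≡p∨∣p∣≡-p (ℚ.∣ a ∣ ℚ.- ℚ.∣ b ∣)
    ... | inj₁ eq = subst (ℚ._≤ ℚ.∣ a ℚ.- b ∣) (sym eq) (∣a∣-∣b∣≤∣a-b∣ a b)
    ... | inj₂ eq = subst₂ ℚ._≤_ (sym (trans eq (neg-sub ℚ.∣ a ∣ ℚ.∣ b ∣)))
      (∣a-b∣-comm b a) (∣a∣-∣b∣≤∣a-b∣ b a)

    1+∣a∣>0 : ∀ a → 0ℚ ℚ.< 1ℚ ℚ.+ ℚ.∣ a ∣
    1+∣a∣>0 a = ℚₚ.+-mono-<-≤ (ℚₚ.positive⁻¹ 1ℚ) (ℚₚ.0≤∣p∣ a)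

    eventuallyBounded : ∀ x → IsCauchy x →
      ∃[ B ] 0ℚ ℚ.< B × ∃[ N ] (∀ n → N ℕ.≤ n → ℚ.∣ x n ∣ ℚ.≤ B)
    eventuallyBounded x xc with xc 1ℚ (ℚₚ.positive⁻¹ 1ℚ)
    ... | N , h = 1ℚ ℚ.+ ℚ.∣ x N ∣ , 1+∣a∣>0 (x N) , N , λ n N≤n →
      ℚₚ.≤-trans (∣a∣≤∣a-b∣+∣b∣ (x n) (x N))
        (ℚₚ.+-monoˡ-≤ ℚ.∣ x N ∣ (ℚₚ.<⇒≤ (h n N N≤n ℕₚ.≤-refl)))

    shrink : ∀ B δ → 0ℚ ℚ.< B → 0ℚ ℚ.< δ → ∃[ η ] 0ℚ ℚ.< η × B ℚ.* η ≡ δ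
    shrink B δ B>0 δ>0 = δ ℚ.* 1/B , ℚₚ.positive⁻¹ (δ ℚ.* 1/B) , (begin
      B ℚ.* (δ ℚ.* 1/B)  ≡⟨ cong (B ℚ.*_) (ℚₚ.*-comm δ 1/B) ⟩
      B ℚ.* (1/B ℚ.* δ)  ≡⟨ ℚₚ.*-assoc B 1/B δ ⟨
      (B ℚ.* 1/B) ℚ.* δ  ≡⟨ cong (ℚ._* δ) (ℚₚ.*-inverseʳ B) ⟩
      1ℚ ℚ.* δ           ≡⟨ ℚₚ.*-identityˡ δ ⟩
      δ                  ∎)
      where
      open ≡-Reasoning
      instance
        B⁺ : ℚ.Positive B
        B⁺ = ℚ.positive B>0
        B≢0 : ℚ.NonZero B
        B≢0 = ℚₚ.pos⇒nonZero B
        δ⁺ : ℚ.Positive δ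
        δ⁺ = ℚ.positive δ>0
      1/B : ℚ
      1/B = ℚ.1/ B
      instance
        1/B⁺ : ℚ.Positive 1/B
        1/B⁺ = ℚₚ.1/pos⇒pos B
        prod⁺ : ℚ.Positive (δ ℚ.* 1/B)
        prod⁺ = ℚₚ.pos*pos⇒pos δ 1/B

    ∣a*b∣<δ : ∀ {B η δ} a b → 0ℚ ℚ.< B → B ℚ.* η ≡ δ →
      ℚ.∣ a ∣ ℚ.≤ B → ℚ.∣ b ∣ ℚ.< η → ℚ.∣ a ℚ.* b ∣ ℚ.< δ
    ∣a*b∣<δ {B} {η} {δ} a b B>0 Bη≡δ a≤B b<η = begin-strict
      ℚ.∣ a ℚ.* b ∣          ≡⟨ ℚₚ.∣p*q∣≡∣p∣*∣q∣ a b ⟩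
      ℚ.∣ a ∣ ℚ.* ℚ.∣ b ∣    ≤⟨ ℚₚ.*-monoʳ-≤-nonNeg ℚ.∣ b ∣ a≤B ⟩
      B ℚ.* ℚ.∣ b ∣          <⟨ ℚₚ.*-monoʳ-<-pos B b<η ⟩
      B ℚ.* η                ≡⟨ Bη≡δ ⟩
      δ                      ∎
      where
      open ℚₚ.≤-Reasoning
      instance
        B⁺ : ℚ.Positive B
        B⁺ = ℚ.positive B>0
        ∣b∣≥0 : ℚ.NonNegative ℚ.∣ b ∣
        ∣b∣≥0 = ℚₚ.∣-∣-nonNeg b

    sum<δ : ∀ {δ} a b → ℚ.∣ a ∣ ℚ.< ½ ℚ.* δ → ℚ.∣ b ∣ ℚ.< ½ ℚ.* δ → ℚ.∣ a ℚ.+ b ∣ ℚ.< δ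
    sum<δ {δ} a b a< b< = ℚₚ.≤-<-trans (ℚₚ.∣p+q∣≤∣p∣+∣q∣ a b)
      (subst (ℚ.∣ a ∣ ℚ.+ ℚ.∣ b ∣ ℚ.<_) (half+half δ) (ℚₚ.+-mono-< a< b<))

    +-cauchy : ∀ x y → IsCauchy x → IsCauchy y → IsCauchy (λ n → x n ℚ.+ y n)
    +-cauchy x y xc yc δ δ>0 with xc (½ ℚ.* δ) (half>0 δ>0) | yc (½ ℚ.* δ) (half>0 δ>0)
    ... | M , hx | N , hy = M ℕ.⊔ N , λ m n ≤m ≤n →
      subst (λ z → ℚ.∣ z ∣ ℚ.< δ) (sym (+-difference (x m) (y m) (x n) (y n)))
        (sum<δ (x m ℚ.- x n) (y m ℚ.- y n)
          (hx m n (ℕₚ.m⊔n≤o⇒m≤o M N ≤m) (ℕₚ.m⊔n≤o⇒m≤o M N ≤n))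
          (hy m n (ℕₚ.m⊔n≤o⇒n≤o M N ≤m) (ℕₚ.m⊔n≤o⇒n≤o M N ≤n)))

    *-cauchy : ∀ x y → IsCauchy x → IsCauchy y → IsCauchy (λ n → x n ℚ.* y n)
    *-cauchy x y xc yc δ δ>0 =
      let B , B>0 , K , hB = eventuallyBounded x xc
          C , C>0 , L , hC = eventuallyBounded y yc
          η , η>0 , Bη     = shrink B (½ ℚ.* δ) B>0 (half>0 δ>0)
          θ , θ>0 , Cθ     = shrink C (½ ℚ.* δ) C>0 (half>0 δ>0)
          M , hy           = yc η η>0
          N , hx           = xc θ θ>0
      in (K ℕ.⊔ L) ℕ.⊔ (M ℕ.⊔ N) , λ m n ≤m ≤n →
        step m n B>0 Bη C>0 Cθ
          (hB m (ℕₚ.m⊔n≤o⇒m≤o K L (ℕₚ.m⊔n≤o⇒m≤o (K ℕ.⊔ L) (M ℕ.⊔ N) ≤m)))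
          (hy m n (ℕₚ.m⊔n≤o⇒m≤o M N (ℕₚ.m⊔n≤o⇒n≤o (K ℕ.⊔ L) (M ℕ.⊔ N) ≤m))
                  (ℕₚ.m⊔n≤o⇒m≤o M N (ℕₚ.m⊔n≤o⇒n≤o (K ℕ.⊔ L) (M ℕ.⊔ N) ≤n)))
          (hC n (ℕₚ.m⊔n≤o⇒n≤o K L (ℕₚ.m⊔n≤o⇒m≤o (K ℕ.⊔ L) (M ℕ.⊔ N) ≤n)))
          (hx m n (ℕₚ.m⊔n≤o⇒n≤o M N (ℕₚ.m⊔n≤o⇒n≤o (K ℕ.⊔ L) (M ℕ.⊔ N) ≤m))
                  (ℕₚ.m⊔n≤o⇒n≤o M N (ℕₚ.m⊔n≤o⇒n≤o (K ℕ.⊔ L) (M ℕ.⊔ N) ≤n)))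
      where
      step : ∀ m n {B C η θ} →
        0ℚ ℚ.< B → B ℚ.* η ≡ ½ ℚ.* δ → 0ℚ ℚ.< C → C ℚ.* θ ≡ ½ ℚ.* δ →
        ℚ.∣ x m ∣ ℚ.≤ B → ℚ.∣ y m ℚ.- y n ∣ ℚ.< η →
        ℚ.∣ y n ∣ ℚ.≤ C → ℚ.∣ x m ℚ.- x n ∣ ℚ.< θ →
        ℚ.∣ x m ℚ.* y m ℚ.- x n ℚ.* y n ∣ ℚ.< δ
      step m n B>0 Bη C>0 Cθ x≤B y<η y≤C x<θ =
        subst (λ z → ℚ.∣ z ∣ ℚ.< δ) (sym (*-difference (x m) (y m) (x n) (y n)))
          (sum<δ (x m ℚ.* (y m ℚ.- y n)) (y n ℚ.* (x m ℚ.- x n))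
            (∣a*b∣<δ (x m) (y m ℚ.- y n) B>0 Bη x≤B y<η)
            (∣a*b∣<δ (y n) (x m ℚ.- x n) C>0 Cθ y≤C x<θ))

    neg-cauchy : ∀ x → IsCauchy x → IsCauchy (λ n → ℚ.- x n)
    neg-cauchy x xc δ δ>0 with xc δ δ>0
    ... | N , h = N , λ m n ≤m ≤n → subst (ℚ._< δ)
      (sym (trans (cong ℚ.∣_∣ (neg-difference (x m) (x n))) (ℚₚ.∣-p∣≡∣p∣ (x m ℚ.- x n))))
      (h m n ≤m ≤n)

    abs-cauchy : ∀ x → IsCauchy x → IsCauchy (λ n → ℚ.∣ x n ∣)
    abs-cauchy x xc δ δ>0 with xc δ δ>0
    ... | N , h = N , λ m n ≤m ≤n →
      ℚₚ.≤-<-trans (∣∣a∣-∣b∣∣≤∣a-b∣ (x m) (x n)) (h m n ≤m ≤n)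

    const-cauchy : ∀ q → IsCauchy (λ _ → q)
    const-cauchy q δ δ>0 = 0 , λ _ _ _ _ →
      subst (ℚ._< δ) (sym (cong ℚ.∣_∣ (ℚₚ.+-inverseʳ q))) δ>0

open CauchyLemmas

infixl 6 _+_ _-_
infixl 7 _*_
infix  8 -_

_+_ _*_ : ℝ → ℝ → ℝ
x + y = mkℝ (λ n → seq x n ℚ.+ seq y n) (+-cauchy (seq x) (seq y) (cauchy x) (cauchy y))
x * y = mkℝ (λ n → seq x n ℚ.* seq y n) (*-cauchy (seq x) (seq y) (cauchy x) (cauchy y))

-_ ∣_∣ : ℝ → ℝ
-_ x  = mkℝ (λ n → ℚ.- seq x n) (neg-cauchy (seq x) (cauchy x))
∣ x ∣ = mkℝ (λ n → ℚ.∣ seq x n ∣) (abs-cauchy (seq x) (cauchy x))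

_-_ : ℝ → ℝ → ℝ
x - y = x + (- y)

fromℚ : ℚ → ℝ
fromℚ q = mkℝ (λ _ → q) (const-cauchy q)

fromℕ : ℕ → ℝ
fromℕ n = fromℚ (+ n ℚ./ 1)

0ℝ 1ℝ : ℝ
0ℝ = fromℚ 0ℚ
1ℝ = fromℚ 1ℚ

∑ ∏ : ∀ {n} → Vector ℝ n → ℝ
∑ = foldr _+_ 0ℝ
∏ = foldr _*_ 1ℝ

------------------------------------------------------------------------
-- Matrices

Matrix : ℕ → Set
Matrix n = Fin n → Fin n → ℝ

-- f 0 - f 1 + f 2 - …, since the fold is f 0 - (f 1 - (f 2 - …)).
alternatingSum : ∀ {n} → Vector ℝ n → ℝ
alternatingSum = foldr _-_ 0ℝ

-- Laplace expansion along the first row.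
det : ∀ {n} → Matrix n → ℝ
det {zero}  A = 1ℝ
det {suc n} A = alternatingSum λ j → A zero j * det (λ k l → A (suc k) (punchIn j l))

identity : ∀ {n} → Matrix n
identity i j = if does (i ≟ᶠ j) then 1ℝ else 0ℝ

charPoly : ∀ {n} → Matrix n → ℝ → ℝ
charPoly A x = det λ i j → x * identity i j - A i j

-- The vector ev lists the eigenvalues of A, each repeated according to its
-- multiplicity as a root of the characteristic polynomial.  This does not
-- depend on the order of the entries, so it describes ev as a multiset.
IsSpectrum : ∀ {n} → Matrix n → Vector ℝ n → Set
IsSpectrum A ev = ∀ x → charPoly A x ≈ ∏ (λ i → x - ev i)

------------------------------------------------------------------------
-- Graphs

data Walk {n} (E : Rel (Fin n) 0ℓ) : ℕ → Rel (Fin n) 0ℓ where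
  []  : ∀ {u} → Walk E 0 u u
  _∷_ : ∀ {k u v w} → E u v → Walk E k v w → Walk E (suc k) u w

record Graph (n : ℕ) : Set₁ where
  field
    E         : Rel (Fin n) 0ℓ
    E?        : Decidable E
    symmetric : Symmetric E
    loopless  : Irreflexive _≡_ E
    connected : ∀ u v → ∃[ k ] Walk E k u v

open Graph public

walk? : ∀ {n} (G : Graph n) k u v → Dec (Walk (E G) k u v)
walk? G zero u v = map′ (λ { refl → [] }) (λ { [] → refl }) (u ≟ᶠ v)
walk? G (suc k) u w = map′ (λ { (v , e , p) → e ∷ p }) (λ { (e ∷ p) → _ , e , p })
  (any? λ v → E? G u v ×-dec walk? G k v w)

least : ∀ {P : U.Pred ℕ 0ℓ} → U.Decidable P → ∀ k → P k →
  ∃[ d ] P d × (∀ {l} → P l → d ℕ.≤ l)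
least P? k pk with P? 0
least P? k       pk | yes p0 = 0 , p0 , λ _ → z≤n
least P? zero    pk | no ¬p0 = contradiction pk ¬p0
least {P} P? (suc k) pk | no ¬p0 with least (P? ∘ suc) k pk
... | d , pd , min = suc d , pd , min′
  where
  min′ : ∀ {l} → P l → suc d ℕ.≤ l
  min′ {zero}  p0 = contradiction p0 ¬p0
  min′ {suc l} pl = s≤s (min pl)

shortest : ∀ {n} (G : Graph n) u v →
  ∃[ d ] Walk (E G) d u v × (∀ {l} → Walk (E G) l u v → d ℕ.≤ l)
shortest G u v =
  least (λ k → walk? G k u v) (proj₁ (connected G u v)) (proj₂ (connected G u v))

dist : ∀ {n} → Graph n → Fin n → Fin n → ℕ
dist G u v = proj₁ (shortest G u v)

ecc : ∀ {n} → Graph n → Fin n → ℕ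
ecc G v = foldr ℕ._⊔_ 0 (dist G v)

εEntry : ∀ {n} → Graph n → Fin n → Fin n → ℕ
εEntry G u v =
  if does (dist G u v ℕₚ.≟ ecc G u ℕ.⊓ ecc G v) then dist G u v else 0

ε : ∀ {n} → Graph n → Matrix n
ε G u v = fromℕ (εEntry G u v)

infix 4 _≅_

_≅_ : ∀ {n} → Graph n → Graph n → Set
_≅_ {n} G H = Σ[ π ∈ Permutation′ n ]
  (∀ u v → E G u v ⇔ E H (π ⟨$⟩ʳ u) (π ⟨$⟩ʳ v))

SameSpectrum : ∀ {n} → Graph n → Graph n → Set
SameSpectrum G H = ∃[ ev ] IsSpectrum (ε G) ev × IsSpectrum (ε H) ev

NonCospectral : ∀ {n} → Graph n → Graph n → Set
NonCospectral G H = ¬ G ≅ H × ¬ SameSpectrum G H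

HasEnergy : ∀ {n} → Graph n → ℝ → Set
HasEnergy G e = ∃[ ev ] IsSpectrum (ε G) ev × e ≈ ∑ (λ i → ∣ ev i ∣)

Equienergetic : ∀ {n} → Graph n → Graph n → Set
Equienergetic G H = ∃[ e ] HasEnergy G e × HasEnergy H e

IsTriplet : ∀ {n} → (Fin 3 → Graph n) → Set
IsTriplet G = ∀ {i j} → i ≢ j → NonCospectral (G i) (G j) × Equienergetic (G i) (G j)

-- Equality of unordered triplets of graphs up to isomorphism.
SameTriplet : ∀ {n} → (S T : Fin 3 → Graph n) → Set
SameTriplet S T = Σ[ π ∈ Permutation′ 3 ] (∀ i → S i ≅ T (π ⟨$⟩ʳ i))

{-# OPTIONS --safe #-}

-- All graphs used are complete bipartite graphs K_{p,q} with p, q ≥ 2.  Every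
-- eccentricity is 2, so ε is 2(J - I) on each of the two parts and 0 between
-- them; its eigenvalues are 2(p-1), 2(q-1) and -2 with multiplicity p + q - 2.
-- The ε-energy 4(p + q - 2) depends on p + q only, whereas the largest
-- eigenvalue and the independence number are determined by max p q.  Hence
-- K_{2,n-2}, K_{3,n-3}, K_{4,n-4}, K_{5,n-5} contain two different triplets.

module Submission where

open import Defs
open import Data.Fin.Base using (Fin)
open import Data.Nat.Base using (ℕ; _≤_) renaming (_+_ to _+ℕ_; _*_ to _*ℕ_)
open import Data.Product.Base using (Σ-syntax; _×_)
open import Relation.Nullary using (¬_)

import Algebra.Definitions.RawSemiring as RawSemiring
import Algebra.Properties.Monoid.Mult as Mult
open import Data.Bool.Base using (Bool; true; false; if_then_else_)
import Data.Bool.Properties as Boolₚ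
open import Data.Empty using (⊥)
open import Data.Fin.Base using (zero; suc; toℕ; punchIn; lift; _↑ˡ_; _↑ʳ_)
open import Data.Fin.Permutation using (_⟨$⟩ʳ_; inverseʳ)
import Data.Fin.Permutation as Perm
open import Data.Fin.Properties using (injective⇒≤; toℕ<n; toℕ-injective;
  punchInᵢ≢i; ↑ˡ-injective; ↑ʳ-injective)
  renaming (_≟_ to _≟ᶠ_)
open import Data.Integer.Base using (+_; -[1+_])
open import Data.Nat.Base as ℕ using (zero; suc; _<_; _∸_; _⊔_; _⊓_; z≤n; s≤s)
import Data.Nat.Properties as ℕₚ
open import Data.Product.Base using (∃-syntax; _,_; proj₁; proj₂)
open import Data.Rational as ℚ using (ℚ; 0ℚ; 1ℚ; ½)
import Data.Rational.Properties as ℚₚ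
open import Data.Rational.Solver using (module +-*-Solver)
open import Data.Sum.Base using (_⊎_; inj₁; inj₂)
open import Data.Vec.Functional as Vector using (Vector; foldr; tail; replicate)
open import Data.Vec.Functional.Relation.Binary.Pointwise.Properties using (foldr-cong)
open import Function.Base using (_∘_)
open import Function.Bundles using (Equivalence; Injection; mk⇔)
open import Function.Definitions using (Injective)
open import Function.Properties.Inverse using (↔⇒↣)
open import Relation.Binary.Definitions using (Tri; tri<; tri≈; tri>)
open import Relation.Binary.PropositionalEquality
open import Relation.Nullary using (Dec; yes; no; does; contradiction)
open import Relation.Nullary.Decidable using (¬?; decidable-stable)

open +-*-Solver using (solve; _:+_; _:-_; _:*_; :-_; _:=_; con)
open RawSemiring ℚ.+-*-rawSemiring using (_^_) renaming (_×_ to _·_)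
open Mult ℚₚ.+-0-monoid using () renaming (×-homo-+ to ·-homo-+)
open ≡-Reasoning

private
  variable
    m n : ℕ
    A : Set

2ℚ -2ℚ : ℚ
2ℚ = + 2 ℚ./ 1
-2ℚ = -[1+ 1 ] ℚ./ 1

-- Determinants of rational matrices

altSum : Vector ℚ n → ℚ
altSum = foldr ℚ._-_ 0ℚ

minor : (Fin (suc m) → Fin (suc n) → ℚ) → Fin (suc n) → Fin m → Fin n → ℚ
minor M j k l = M (suc k) (punchIn j l)

-- Real operations act termwise on sequences, so a real determinant read at one index is this
-- rational one. The algebra is done here, where equality is propositional.
detℚ : (Fin n → Fin n → ℚ) → ℚ
detℚ {zero}  M = 1ℚ
detℚ {suc n} M = altSum λ j → M zero j ℚ.* detℚ (minor M j)

altSum-cong : {u v : Vector ℚ n} → u ≗ v → altSum u ≡ altSum v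
altSum-cong = foldr-cong {R = _≡_} {S = _≡_} (cong₂ ℚ._-_) refl

altSum-zero : {u : Vector ℚ n} → (∀ i → u i ≡ 0ℚ) → altSum u ≡ 0ℚ
altSum-zero {zero}  u≡0 = refl
altSum-zero {suc n} u≡0 = cong₂ ℚ._-_ (u≡0 zero) (altSum-zero (u≡0 ∘ suc))

altSum-sub : (u v : Vector ℚ n) →
  altSum (λ i → u i ℚ.- v i) ≡ altSum u ℚ.- altSum v
altSum-sub {zero}  u v = refl
altSum-sub {suc n} u v = trans
  (cong (ℚ._-_ (u zero ℚ.- v zero)) (altSum-sub (tail u) (tail v)))
  (solve 4 (λ a b s t → (a :- b) :- (s :- t) := (a :- s) :- (b :- t)) refl
    (u zero) (v zero) (altSum (tail u)) (altSum (tail v)))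

altSum-scale : (c : ℚ) (u : Vector ℚ n) →
  altSum (λ i → c ℚ.* u i) ≡ c ℚ.* altSum u
altSum-scale {zero}  c u = sym (ℚₚ.*-zeroʳ c)
altSum-scale {suc n} c u = trans
  (cong (ℚ._-_ (c ℚ.* u zero)) (altSum-scale c (tail u)))
  (solve 3 (λ c a s → c :* a :- c :* s := c :* (a :- s)) refl
    c (u zero) (altSum (tail u)))

detℚ-cong : {M N : Fin n → Fin n → ℚ} → (∀ i j → M i j ≡ N i j) → detℚ M ≡ detℚ N
detℚ-cong {zero}  M≡N = refl
detℚ-cong {suc n} M≡N = altSum-cong λ j →
  cong₂ ℚ._*_ (M≡N zero j) (detℚ-cong λ k l → M≡N (suc k) (punchIn j l))

lift-cong : {σ τ : Fin m → Fin n} → σ ≗ τ → lift 1 σ ≗ lift 1 τ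
lift-cong σ≗τ zero    = refl
lift-cong σ≗τ (suc i) = cong suc (σ≗τ i)

punchIn²-lift : (j : Fin (suc (suc n))) (k : Fin (suc n)) →
  punchIn (suc j) ∘ punchIn (suc k) ≗ lift 1 (punchIn j ∘ punchIn k)
punchIn²-lift j k zero    = refl
punchIn²-lift j k (suc l) = refl

-- The Laplace expansion along two equal rows r, where F σ stands for the
-- determinant formed by the remaining rows and the columns in the image of σ.
-- The terms with j = 0 cancel those with k = 0, and what remains is an
-- expansion of the same kind in one variable less.
altSum²≡0 : (r : Vector ℚ (suc (suc n))) (F : (Fin n → Fin (suc (suc n))) → ℚ) →
  (∀ {σ τ} → σ ≗ τ → F σ ≡ F τ) →
  (altSum λ j → r j ℚ.* altSum λ k → r (punchIn j k) ℚ.* F (punchIn j ∘ punchIn k)) ≡ 0ℚ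
altSum²≡0 {zero} r F F-cong = trans
  (cong (λ f → r zero ℚ.* (r (suc zero) ℚ.* F (punchIn zero ∘ punchIn zero) ℚ.- 0ℚ) ℚ.-
    (r (suc zero) ℚ.* (r zero ℚ.* f ℚ.- 0ℚ) ℚ.- 0ℚ))
    -- Both maps have empty domain, so `F` takes the same value on them.
    (F-cong {punchIn (suc zero) ∘ punchIn zero} {punchIn zero ∘ punchIn zero} λ ()))
  (solve 3 (λ a b f → a :* (b :* f :- con 0ℚ) :- (b :* (a :* f :- con 0ℚ) :- con 0ℚ) := con 0ℚ)
    refl (r zero) (r (suc zero)) (F (punchIn zero ∘ punchIn zero)))
altSum²≡0 {suc n} r F F-cong = begin
  r₀ ℚ.* altSum h ℚ.- altSum (λ j → r (suc j) ℚ.* (r₀ ℚ.* f j ℚ.- altSum (g j)))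
    ≡⟨ cong (ℚ._-_ (r₀ ℚ.* altSum h)) (altSum-cong split) ⟩
  r₀ ℚ.* altSum h ℚ.- altSum (λ j → r₀ ℚ.* h j ℚ.- r (suc j) ℚ.* altSum (g j))
    ≡⟨ cong (ℚ._-_ (r₀ ℚ.* altSum h))
         (altSum-sub (λ j → r₀ ℚ.* h j) (λ j → r (suc j) ℚ.* altSum (g j))) ⟩
  r₀ ℚ.* altSum h ℚ.- (altSum (λ j → r₀ ℚ.* h j) ℚ.- altSum (λ j → r (suc j) ℚ.* altSum (g j)))
    ≡⟨ cong₂ (λ s t → r₀ ℚ.* altSum h ℚ.- (s ℚ.- t)) (altSum-scale r₀ h) rest≡0 ⟩
  r₀ ℚ.* altSum h ℚ.- (r₀ ℚ.* altSum h ℚ.- 0ℚ)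
    ≡⟨ solve 1 (λ s → s :- (s :- con 0ℚ) := con 0ℚ) refl (r₀ ℚ.* altSum h) ⟩
  0ℚ ∎
  where
  r₀ : ℚ
  r₀ = r zero
  h f : Vector ℚ (suc (suc n))
  h k = r (suc k) ℚ.* F (suc ∘ punchIn k)
  f j = F (punchIn (suc j) ∘ suc)
  g : Fin (suc (suc n)) → Vector ℚ (suc n)
  g j k = r (suc (punchIn j k)) ℚ.* F (punchIn (suc j) ∘ punchIn (suc k))
  split : ∀ j → r (suc j) ℚ.* (r₀ ℚ.* f j ℚ.- altSum (g j)) ≡
    r₀ ℚ.* h j ℚ.- r (suc j) ℚ.* altSum (g j)
  -- `punchIn (suc j) ∘ suc` computes to `suc ∘ punchIn j`, so `f j` is the value of `F` occurring
  -- in `h j`.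
  split j = solve 4 (λ a b f s → a :* (b :* f :- s) := b :* (a :* f) :- a :* s) refl
    (r (suc j)) r₀ (f j) (altSum (g j))
  rest≡0 : altSum (λ j → r (suc j) ℚ.* altSum (g j)) ≡ 0ℚ
  rest≡0 = trans
    (altSum-cong λ j → cong (r (suc j) ℚ.*_) (altSum-cong λ k →
      cong (r (suc (punchIn j k)) ℚ.*_) (F-cong (punchIn²-lift j k))))
    (altSum²≡0 (r ∘ suc) (F ∘ lift 1) (F-cong ∘ lift-cong))

-- The two sides differ by an expansion whose first two rows coincide, which vanishes by
-- `altSum²≡0`.
detℚ-subtractRow : (M : Fin (suc (suc n)) → Fin (suc (suc n)) → ℚ) →
  detℚ M ≡ altSum λ j → (M zero j ℚ.- M (suc zero) j) ℚ.* detℚ (minor M j)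
detℚ-subtractRow M = sym (begin
  altSum (λ j → (M zero j ℚ.- r j) ℚ.* d j)
    ≡⟨ altSum-cong (λ j → solve 3 (λ a b d → (a :- b) :* d := a :* d :- b :* d) refl
         (M zero j) (r j) (d j)) ⟩
  altSum (λ j → M zero j ℚ.* d j ℚ.- r j ℚ.* d j)
    ≡⟨ altSum-sub (λ j → M zero j ℚ.* d j) (λ j → r j ℚ.* d j) ⟩
  detℚ M ℚ.- altSum (λ j → r j ℚ.* d j)
    ≡⟨ cong (ℚ._-_ (detℚ M)) (altSum²≡0 r
         (λ σ → detℚ λ k l → M (suc (suc k)) (σ l))
         (λ σ≗τ → detℚ-cong λ k l → cong (M (suc (suc k))) (σ≗τ l))) ⟩
  detℚ M ℚ.- 0ℚ
    ≡⟨ solve 1 (λ s → s :- con 0ℚ := s) refl (detℚ M) ⟩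
  detℚ M ∎)
  where
  r = M (suc zero)
  d = λ j → detℚ (minor M j)

-- Determinants of block-diagonal matrices

-- The labels `w` begin with a run of `k + 1` equal labels, followed by `w′`. The label of the run
-- never returns, so its block decouples from the others.
data Block {A : Set} : ∀ {m n} → ℕ → Vector A m → Vector A n → Set where
  last : {w : Vector A (suc n)} → (∀ j → w zero ≢ w (suc j)) → Block 0 w (tail w)
  more : ∀ {k} {w : Vector A (suc (suc m))} {w′ : Vector A n} →
    w zero ≡ w (suc zero) → Block k (tail w) w′ → Block (suc k) w w′

module BlockDet (c y : ℚ) where

  within : Bool → Bool → ℚ
  within s t = if does (s Boolₚ.≟ t) then c else 0ℚ

  diagonal : ℚ → Fin n → Fin n → ℚ
  diagonal z zero    zero    = z
  diagonal z zero    (suc j) = 0ℚ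
  diagonal z (suc i) zero    = 0ℚ
  diagonal z (suc i) (suc j) = diagonal y i j

  -- The block-diagonal matrix with blocks c J + y I, except that the corner
  -- entry is c + z.  The two values of z that matter are y and 0.
  blocks : ℚ → Vector Bool n → Fin n → Fin n → ℚ
  blocks z w i j = within (w i) (w j) ℚ.+ diagonal z i j

  within-refl : ∀ s → within s s ≡ c
  within-refl false = refl
  within-refl true  = refl

  within-≢ : ∀ {s t} → s ≢ t → within s t ≡ 0ℚ
  within-≢ {s} {t} s≢t with s Boolₚ.≟ t
  ... | yes s≡t = contradiction s≡t s≢t
  ... | no  _   = refl

  -- Deleting row 0 and column 1 leaves a diagonal part with corner 0; this is why the corner is a
  -- parameter of `diagonal`.
  diagonal-zeroʳ : (i : Fin (suc n)) → diagonal y (suc i) zero ≡ diagonal 0ℚ i zero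
  diagonal-zeroʳ zero    = refl
  diagonal-zeroʳ (suc i) = refl

  diagonal-sucʳ : (i : Fin (suc n)) (j : Fin n) →
    diagonal y (suc i) (suc (suc j)) ≡ diagonal 0ℚ i (suc j)
  diagonal-sucʳ zero    j = refl
  diagonal-sucʳ (suc i) j = refl

  -- Equal labels give equal rows apart from the diagonal. After subtracting the second row from the
  -- first, only `z` and `- y` remain, in columns 0 and 1; their minors have the same shape, with
  -- corner `y` and 0.
  det-more : ∀ z (w : Vector Bool (suc (suc n))) → w zero ≡ w (suc zero) →
    detℚ (blocks z w) ≡ z ℚ.* detℚ (blocks y (tail w)) ℚ.+ y ℚ.* detℚ (blocks 0ℚ (tail w))
  det-more z w w₀≡w₁ = begin
    detℚ M
      ≡⟨ detℚ-subtractRow M ⟩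
    (M zero zero ℚ.- M (suc zero) zero) ℚ.* d ℚ.-
    ((M zero (suc zero) ℚ.- M (suc zero) (suc zero)) ℚ.* detℚ (minor M (suc zero)) ℚ.-
     altSum (λ j → (M zero (suc (suc j)) ℚ.- M (suc zero) (suc (suc j))) ℚ.* detℚ (minor M (suc (suc j)))))
      ≡⟨ cong₂ ℚ._-_ (cong (ℚ._* d) col₀)
           (cong₂ ℚ._-_ (cong₂ ℚ._*_ col₁ (detℚ-cong minor₁)) (altSum-zero cols)) ⟩
    z ℚ.* d ℚ.- (ℚ.- y ℚ.* e ℚ.- 0ℚ)
      ≡⟨ solve 4 (λ z d y e → z :* d :- ((:- y) :* e :- con 0ℚ) := z :* d :+ y :* e) refl z d y e ⟩
    z ℚ.* d ℚ.+ y ℚ.* e ∎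
    where
    M = blocks z w
    d = detℚ (blocks y (tail w))
    e = detℚ (blocks 0ℚ (tail w))
    col₀ : M zero zero ℚ.- M (suc zero) zero ≡ z
    col₀ rewrite w₀≡w₁ =
      solve 2 (λ g z → (g :+ z) :- (g :+ con 0ℚ) := z) refl (within (w (suc zero)) (w (suc zero))) z
    col₁ : M zero (suc zero) ℚ.- M (suc zero) (suc zero) ≡ ℚ.- y
    col₁ rewrite w₀≡w₁ =
      solve 2 (λ g y → (g :+ con 0ℚ) :- (g :+ y) := :- y) refl (within (w (suc zero)) (w (suc zero))) y
    cols : ∀ j → (M zero (suc (suc j)) ℚ.- M (suc zero) (suc (suc j))) ℚ.*
      detℚ (minor M (suc (suc j))) ≡ 0ℚ
    cols j = trans
      (cong (λ s → ((within s (w (suc (suc j))) ℚ.+ 0ℚ) ℚ.- M (suc zero) (suc (suc j))) ℚ.* x) w₀≡w₁)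
      (solve 2 (λ g x → ((g :+ con 0ℚ) :- (g :+ con 0ℚ)) :* x := con 0ℚ) refl
        (within (w (suc zero)) (w (suc (suc j)))) x)
      where x = detℚ (minor M (suc (suc j)))
    minor₁ : ∀ i j → minor M (suc zero) i j ≡ blocks 0ℚ (tail w) i j
    minor₁ i zero    = cong₂ ℚ._+_ (cong (within (w (suc i))) w₀≡w₁) (diagonal-zeroʳ i)
    minor₁ i (suc j) = cong (within (w (suc i)) (w (suc (suc j))) ℚ.+_) (diagonal-sucʳ i j)

  det-last : ∀ z (w : Vector Bool (suc n)) → (∀ j → w zero ≢ w (suc j)) →
    detℚ (blocks z w) ≡ (c ℚ.+ z) ℚ.* detℚ (blocks y (tail w))
  det-last z w w₀≢ = begin
    (within (w zero) (w zero) ℚ.+ z) ℚ.* d ℚ.-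
    altSum (λ j → (within (w zero) (w (suc j)) ℚ.+ 0ℚ) ℚ.* detℚ (minor (blocks z w) (suc j)))
      ≡⟨ cong₂ (λ g s → (g ℚ.+ z) ℚ.* d ℚ.- s) (within-refl (w zero)) (altSum-zero λ j →
           trans (cong (λ g → (g ℚ.+ 0ℚ) ℚ.* detℚ (minor (blocks z w) (suc j))) (within-≢ (w₀≢ j)))
                 (ℚₚ.*-zeroˡ (detℚ (minor (blocks z w) (suc j))))) ⟩
    (c ℚ.+ z) ℚ.* d ℚ.- 0ℚ
      ≡⟨ solve 1 (λ s → s :- con 0ℚ := s) refl ((c ℚ.+ z) ℚ.* d) ⟩
    (c ℚ.+ z) ℚ.* d ∎
    where
    d = detℚ (blocks y (tail w))

  -- With corner 0 only the second term of `det-more` survives: each reduction gives a factor `y`,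
  -- until the corner is `c` alone.
  det-block₀ : ∀ {k} {w : Vector Bool m} {w′ : Vector Bool n} → Block k w w′ →
    detℚ (blocks 0ℚ w) ≡ c ℚ.* y ^ k ℚ.* detℚ (blocks y w′)
  det-block₀ {w = w} (last w₀≢) = trans (det-last 0ℚ w w₀≢)
    (solve 2 (λ c d → (c :+ con 0ℚ) :* d := c :* con 1ℚ :* d) refl c (detℚ (blocks y (tail w))))
  det-block₀ {w = w} {w′ = w′} (more {k = k} w₀≡w₁ b) = begin
    detℚ (blocks 0ℚ w)
      ≡⟨ det-more 0ℚ w w₀≡w₁ ⟩
    0ℚ ℚ.* detℚ (blocks y (tail w)) ℚ.+ y ℚ.* detℚ (blocks 0ℚ (tail w))
      ≡⟨ cong (λ e → 0ℚ ℚ.* detℚ (blocks y (tail w)) ℚ.+ y ℚ.* e) (det-block₀ b) ⟩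
    0ℚ ℚ.* detℚ (blocks y (tail w)) ℚ.+ y ℚ.* (c ℚ.* y ^ k ℚ.* detℚ (blocks y w′))
      ≡⟨ solve 5 (λ x c y p d → con 0ℚ :* x :+ y :* (c :* p :* d) := c :* (y :* p) :* d) refl
           (detℚ (blocks y (tail w))) c y (y ^ k) (detℚ (blocks y w′)) ⟩
    c ℚ.* y ^ suc k ℚ.* detℚ (blocks y w′) ∎

  -- The factor split off is the determinant of `c J + y I` of size `k + 1`. Each reduction gives a
  -- factor `y`, and the corner-0 term adds one more `c` to the eigenvalue of the all-ones vector.
  det-block : ∀ {k} {w : Vector Bool m} {w′ : Vector Bool n} → Block k w w′ →
    detℚ (blocks y w) ≡ (y ℚ.+ suc k · c) ℚ.* y ^ k ℚ.* detℚ (blocks y w′)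
  det-block {w = w} (last w₀≢) = trans (det-last y w w₀≢)
    (solve 3 (λ c y d → (c :+ y) :* d := (y :+ (c :+ con 0ℚ)) :* con 1ℚ :* d) refl
      c y (detℚ (blocks y (tail w))))
  det-block {w = w} {w′ = w′} (more {k = k} w₀≡w₁ b) = begin
    detℚ (blocks y w)
      ≡⟨ det-more y w w₀≡w₁ ⟩
    y ℚ.* detℚ (blocks y (tail w)) ℚ.+ y ℚ.* detℚ (blocks 0ℚ (tail w))
      ≡⟨ cong₂ (λ d e → y ℚ.* d ℚ.+ y ℚ.* e) (det-block b) (det-block₀ b) ⟩
    y ℚ.* ((y ℚ.+ suc k · c) ℚ.* y ^ k ℚ.* d) ℚ.+ y ℚ.* (c ℚ.* y ^ k ℚ.* d)
      ≡⟨ solve 5 (λ y s p d c → y :* ((y :+ s) :* p :* d) :+ y :* (c :* p :* d) :=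
           (y :+ (c :+ s)) :* (y :* p) :* d) refl y (suc k · c) (y ^ k) d c ⟩
    (y ℚ.+ suc (suc k) · c) ℚ.* y ^ suc k ℚ.* d ∎
    where
    d = detℚ (blocks y w′)

-- Evaluating reals at an index

seq-foldr : ∀ k (_∙_ : ℝ → ℝ → ℝ) (_∘′_ : ℚ → ℚ → ℚ) e →
  (∀ x y → seq (x ∙ y) k ≡ seq x k ∘′ seq y k) →
  (u : Vector ℝ n) → seq (foldr _∙_ e u) k ≡ foldr _∘′_ (seq e k) (λ i → seq (u i) k)
seq-foldr {n = zero}  k _∙_ _∘′_ e homo u = refl
seq-foldr {n = suc n} k _∙_ _∘′_ e homo u = trans
  (homo (u zero) (foldr _∙_ e (tail u)))
  (cong (seq (u zero) k ∘′_) (seq-foldr k _∙_ _∘′_ e homo (tail u)))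

seq-det : ∀ k (M : Matrix n) → seq (det M) k ≡ detℚ (λ i j → seq (M i j) k)
seq-det {zero}  k M = refl
seq-det {suc n} k M = trans
  (seq-foldr k _-_ ℚ._-_ 0ℝ (λ _ _ → refl)
    (λ j → M zero j * det (λ i l → M (suc i) (punchIn j l))))
  (altSum-cong λ j → cong (seq (M zero j) k ℚ.*_) (seq-det k λ i l → M (suc i) (punchIn j l)))

≗⇒≈ : ∀ x y → seq x ≗ seq y → x ≈ y
≗⇒≈ x y x≗y δ δ>0 = 0 , λ k _ → subst (λ q → ℚ.∣ q ∣ ℚ.< δ)
  (sym (trans (cong (ℚ._- seq y k) (x≗y k)) (ℚₚ.+-inverseʳ (seq y k)))) δ>0

-- At a common late index, `z` would lie within `q / 2` of both 0 and `q`, against the triangle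
-- inequality.
0≉positive : ∀ {x y z q} → (∀ k → seq x k ≡ 0ℚ) → (∀ k → seq y k ≡ q) → 0ℚ ℚ.< q →
  x ≈ z → y ≈ z → ⊥
0≉positive {x} {y} {z} {q} x≡0 y≡q 0<q x≈z y≈z
  with x≈z (½ ℚ.* q) (CauchyLemmas.half>0 0<q) | y≈z (½ ℚ.* q) (CauchyLemmas.half>0 0<q)
... | M , hx | N , hy = ℚₚ.<-irrefl refl (subst (ℚ._< q) ∣sum∣≡q
  (CauchyLemmas.sum<δ (q ℚ.- s) (s ℚ.- 0ℚ)
    (subst (λ p → ℚ.∣ p ℚ.- s ∣ ℚ.< ½ ℚ.* q) (y≡q k) (hy k (ℕₚ.m≤n⊔m M N)))
    (subst (ℚ._< ½ ℚ.* q) (trans (cong (λ p → ℚ.∣ p ℚ.- s ∣) (x≡0 k)) (CauchyLemmas.∣a-b∣-comm 0ℚ s))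
      (hx k (ℕₚ.m≤m⊔n M N)))))
  where
  k = M ⊔ N
  s = seq z k
  ∣sum∣≡q : ℚ.∣ (q ℚ.- s) ℚ.+ (s ℚ.- 0ℚ) ∣ ≡ q
  ∣sum∣≡q = trans
    (cong ℚ.∣_∣ (solve 2 (λ q s → (q :- s) :+ (s :- con 0ℚ) := q) refl q s))
    (ℚₚ.0≤p⇒∣p∣≡p (ℚₚ.<⇒≤ 0<q))

-- Distances, eccentricities, independent sets

-- Distances can thus be found from a walk and a lower bound, without running the search behind
-- `dist`.
dist-unique : ∀ (G : Graph n) u v {d} → Walk (E G) d u v →
  (∀ {l} → Walk (E G) l u v → d ≤ l) → dist G u v ≡ d
dist-unique G u v walk shortest′ = ℕₚ.≤-antisym
  (proj₂ (proj₂ (shortest G u v)) walk) (shortest′ (proj₁ (proj₂ (shortest G u v))))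

foldr-⊔-≤ : ∀ {d} (f : Vector ℕ n) → (∀ i → f i ≤ d) → foldr _⊔_ 0 f ≤ d
foldr-⊔-≤ {zero}  f f≤d = z≤n
foldr-⊔-≤ {suc n} f f≤d = ℕₚ.⊔-lub (f≤d zero) (foldr-⊔-≤ (tail f) (f≤d ∘ suc))

≤-foldr-⊔ : (f : Vector ℕ n) → ∀ i → f i ≤ foldr _⊔_ 0 f
≤-foldr-⊔ f zero    = ℕₚ.m≤m⊔n _ _
≤-foldr-⊔ f (suc i) = ℕₚ.≤-trans (≤-foldr-⊔ (tail f) i) (ℕₚ.m≤n⊔m (f zero) _)

εEntry-cong : ∀ (G : Graph n) u v {d e f} → dist G u v ≡ d → ecc G u ≡ e → ecc G v ≡ f →
  εEntry G u v ≡ (if does (d ℕₚ.≟ e ⊓ f) then d else 0)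
εEntry-cong G u v refl refl refl = refl

-- Serves as the isomorphism invariant: it is transported along an isomorphism without studying
-- `det` under permutations.
IndependentSet : Graph n → ℕ → Set
IndependentSet {n} G k =
  Σ[ f ∈ (Fin k → Fin n) ] Injective _≡_ _≡_ f × (∀ i j → ¬ E G (f i) (f j))

≅-sym : {G H : Graph n} → G ≅ H → H ≅ G
≅-sym {H = H} (π , iso) = Perm.flip π , λ u v → mk⇔
  (λ e → Equivalence.from (iso _ _) (subst₂ (E H) (sym (inverseʳ π)) (sym (inverseʳ π)) e))
  (λ e → subst₂ (E H) (inverseʳ π) (inverseʳ π) (Equivalence.to (iso _ _) e))

≅-independentSet : ∀ {G H : Graph n} {k} → G ≅ H → IndependentSet G k → IndependentSet H k
≅-independentSet (π , iso) (f , f-inj , f-indep) =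
  (π ⟨$⟩ʳ_) ∘ f , f-inj ∘ Injection.injective (↔⇒↣ π) ,
  λ i j → f-indep i j ∘ Equivalence.from (iso _ _)

NonCospectral-sym : {G H : Graph n} → NonCospectral G H → NonCospectral H G
NonCospectral-sym {G = G} {H} (G≇H , G≁H) =
  (λ H≅G → G≇H (≅-sym {G = H} {G} H≅G)) , (λ { (ev , hH , hG) → G≁H (ev , hG , hH) })

-- Complete bipartite graphs

-- `opposite` provides walks of length 2 inside a part, hence connectedness; `mate` makes every
-- eccentricity reach 2.
module CompleteBipartite {n} (side : Vector Bool n)
  (mate     : ∀ u → ∃[ v ] v ≢ u × side u ≡ side v)
  (opposite : ∀ u → ∃[ v ] side u ≢ side v) where

  Edge : Fin n → Fin n → Set
  Edge u v = side u ≢ side v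

  edge? : ∀ u v → Dec (Edge u v)
  edge? u v = ¬? (side u Boolₚ.≟ side v)

  walk₂ : ∀ {u v} → side u ≡ side v → Walk Edge 2 u v
  walk₂ {u} u~v with opposite u
  ... | w , u≁w = u≁w ∷ ((λ w~v → u≁w (trans u~v (sym w~v))) ∷ [])

  graph : Graph n
  graph .E = Edge
  graph .E? = edge?
  graph .symmetric = ≢-sym
  graph .loopless refl u≁u = u≁u refl
  graph .connected u v with side u Boolₚ.≟ side v
  ... | yes u~v = 2 , walk₂ u~v
  ... | no  u≁v = 1 , u≁v ∷ []

  dist-edge : ∀ {u v} → Edge u v → dist graph u v ≡ 1
  dist-edge {u} {v} u≁v = dist-unique graph u v (u≁v ∷ []) λ
    { {zero} [] → contradiction refl u≁v ; {suc l} _ → s≤s z≤n }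

  dist-mate : ∀ {u v} → v ≢ u → side u ≡ side v → dist graph u v ≡ 2
  dist-mate {u} {v} v≢u u~v = dist-unique graph u v (walk₂ u~v) λ
    { {zero} [] → contradiction refl v≢u
    ; {suc zero} (u≁v ∷ []) → contradiction u~v u≁v
    ; {suc (suc l)} _ → s≤s (s≤s z≤n) }

  dist-self : ∀ u → dist graph u u ≡ 0
  dist-self u = dist-unique graph u u [] λ _ → z≤n

  dist≤2 : ∀ u v → dist graph u v ≤ 2
  dist≤2 u v = bound (side u Boolₚ.≟ side v) (v ≟ᶠ u)
    where
    bound : Dec (side u ≡ side v) → Dec (v ≡ u) → dist graph u v ≤ 2
    bound (no  u≁v) _          = subst (_≤ 2) (sym (dist-edge u≁v)) (s≤s z≤n)
    bound (yes _)   (yes refl) = subst (_≤ 2) (sym (dist-self u)) z≤n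
    bound (yes u~v) (no v≢u)   = ℕₚ.≤-reflexive (dist-mate v≢u u~v)

  ecc≡2 : ∀ u → ecc graph u ≡ 2
  ecc≡2 u with mate u
  ... | v , v≢u , u~v = ℕₚ.≤-antisym (foldr-⊔-≤ (dist graph u) (dist≤2 u))
    (subst (_≤ ecc graph u) (dist-mate v≢u u~v) (≤-foldr-⊔ (dist graph u) v))

  εEntry-edge : ∀ {u v} → Edge u v → εEntry graph u v ≡ 0
  εEntry-edge {u} {v} e = εEntry-cong graph u v (dist-edge e) (ecc≡2 u) (ecc≡2 v)

  εEntry-mate : ∀ {u v} → v ≢ u → side u ≡ side v → εEntry graph u v ≡ 2
  εEntry-mate {u} {v} v≢u u~v = εEntry-cong graph u v (dist-mate v≢u u~v) (ecc≡2 u) (ecc≡2 v)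

  εEntry-self : ∀ u → εEntry graph u u ≡ 0
  εEntry-self u = εEntry-cong graph u u (dist-self u) (ecc≡2 u) (ecc≡2 u)

  seq-identity : ∀ k (i j : Fin n) → seq (identity i j) k ≡ (if does (i ≟ᶠ j) then 1ℚ else 0ℚ)
  seq-identity k i j with does (i ≟ᶠ j)
  ... | true  = refl
  ... | false = refl

  module _ (q : ℚ) where

    open BlockDet -2ℚ (q ℚ.+ 2ℚ)

    diagonal-self : (i : Fin m) → diagonal (q ℚ.+ 2ℚ) i i ≡ q ℚ.+ 2ℚ
    diagonal-self zero    = refl
    diagonal-self (suc i) = diagonal-self i

    diagonal-≢ : {i j : Fin m} → i ≢ j → diagonal (q ℚ.+ 2ℚ) i j ≡ 0ℚ
    diagonal-≢ {i = zero}  {zero}  i≢j = contradiction refl i≢j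
    diagonal-≢ {i = zero}  {suc j} i≢j = refl
    diagonal-≢ {i = suc i} {zero}  i≢j = refl
    diagonal-≢ {i = suc i} {suc j} i≢j = diagonal-≢ (i≢j ∘ cong suc)

    -- Since `q = -2 + (q + 2)` on the diagonal, the matrix `q I - ε` has blocks `c J + y I` with
    -- `c = -2` and `y = q + 2`. The entry of `ε` is a variable `e`, so that it can be rewritten to
    -- 0 or 2.
    entry : ∀ i j e → (Edge i j → e ≡ 0) → (j ≢ i → side i ≡ side j → e ≡ 2) → (i ≡ j → e ≡ 0) →
      q ℚ.* (if does (i ≟ᶠ j) then 1ℚ else 0ℚ) ℚ.- + e ℚ./ 1 ≡ blocks (q ℚ.+ 2ℚ) side i j
    entry i j e edge mate′ self with i ≟ᶠ j | side i Boolₚ.≟ side j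
    ... | yes refl | yes _   rewrite self refl = trans
      (solve 1 (λ q → q :* con 1ℚ :- con 0ℚ := con -2ℚ :+ (q :+ con 2ℚ)) refl q)
      (cong (-2ℚ ℚ.+_) (sym (diagonal-self i)))
    ... | yes refl | no i≁i  = contradiction refl i≁i
    ... | no i≢j   | yes i~j rewrite mate′ (i≢j ∘ sym) i~j = trans
      (solve 1 (λ q → q :* con 0ℚ :- con 2ℚ := con -2ℚ :+ con 0ℚ) refl q)
      (cong (-2ℚ ℚ.+_) (sym (diagonal-≢ i≢j)))
    ... | no i≢j   | no i≁j  rewrite edge i≁j = trans
      (solve 1 (λ q → q :* con 0ℚ :- con 0ℚ := con 0ℚ :+ con 0ℚ) refl q)
      (cong (0ℚ ℚ.+_) (sym (diagonal-≢ i≢j)))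

  seq-charPoly : ∀ x k →
    let q = seq x k in
    seq (charPoly (ε graph) x) k ≡ detℚ (BlockDet.blocks -2ℚ (q ℚ.+ 2ℚ) (q ℚ.+ 2ℚ) side)
  seq-charPoly x k = trans (seq-det k λ i j → x * identity i j - ε graph i j)
    (detℚ-cong λ i j → trans
      (cong (λ p → seq x k ℚ.* p ℚ.- + εEntry graph i j ℚ./ 1) (seq-identity k i j))
      (entry (seq x k) i j (εEntry graph i j) εEntry-edge εEntry-mate λ { refl → εEntry-self i }))

-- Splitting the vertices into two consecutive parts

firstPart : ℕ → Vector Bool n
firstPart zero    _       = false
firstPart (suc a) zero    = true
firstPart (suc a) (suc i) = firstPart a i

firstPart-↑ˡ : ∀ a b (i : Fin a) → firstPart a (i ↑ˡ b) ≡ true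
firstPart-↑ˡ (suc a) b zero    = refl
firstPart-↑ˡ (suc a) b (suc i) = firstPart-↑ˡ a b i

firstPart-↑ʳ : ∀ a {b} (i : Fin b) → firstPart a (a ↑ʳ i) ≡ false
firstPart-↑ʳ zero    i = refl
firstPart-↑ʳ (suc a) i = firstPart-↑ʳ a i

firstPart-true : ∀ a b (i : Fin (a +ℕ b)) → firstPart a i ≡ true → ∃[ j ] j ↑ˡ b ≡ i
firstPart-true (suc a) b zero    _ = zero , refl
firstPart-true (suc a) b (suc i) p with firstPart-true a b i p
... | j , refl = suc j , refl

firstPart-false : ∀ a {b} (i : Fin (a +ℕ b)) → firstPart a i ≡ false → ∃[ j ] a ↑ʳ j ≡ i
firstPart-false zero    i       _ = i , refl
firstPart-false (suc a) (suc i) p with firstPart-false a i p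
... | j , refl = j , refl

-- Rational spectra and energies

prepend : ∀ k → A → Vector A n → Vector A (k +ℕ n)
prepend zero    x u = u
prepend (suc k) x u = x Vector.∷ prepend k x u

-- The eigenvalues of `2(J - I)` on blocks of sizes `suc a` and `suc b`, listed block by block.
spectrum : ∀ a b → Vector ℚ (suc a +ℕ suc b)
spectrum a b = (a · 2ℚ) Vector.∷ prepend a -2ℚ ((b · 2ℚ) Vector.∷ replicate b -2ℚ)

charPolyℚ : ℚ → Vector ℚ n → ℚ
charPolyℚ q u = foldr ℚ._*_ 1ℚ (λ i → q ℚ.- u i)

energyℚ : Vector ℚ n → ℚ
energyℚ u = foldr ℚ._+_ 0ℚ (λ i → ℚ.∣ u i ∣)

charPolyℚ-prepend : ∀ q k x (u : Vector ℚ n) →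
  charPolyℚ q (prepend k x u) ≡ (q ℚ.- x) ^ k ℚ.* charPolyℚ q u
charPolyℚ-prepend q zero    x u = sym (ℚₚ.*-identityˡ (charPolyℚ q u))
charPolyℚ-prepend q (suc k) x u = trans
  (cong ((q ℚ.- x) ℚ.*_) (charPolyℚ-prepend q k x u))
  (sym (ℚₚ.*-assoc (q ℚ.- x) ((q ℚ.- x) ^ k) (charPolyℚ q u)))

charPolyℚ-replicate : ∀ q k x → charPolyℚ q (replicate k x) ≡ (q ℚ.- x) ^ k
charPolyℚ-replicate q zero    x = refl
charPolyℚ-replicate q (suc k) x = cong ((q ℚ.- x) ℚ.*_) (charPolyℚ-replicate q k x)

energyℚ-prepend : ∀ k x (u : Vector ℚ n) →
  energyℚ (prepend k x u) ≡ k · ℚ.∣ x ∣ ℚ.+ energyℚ u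
energyℚ-prepend zero    x u = sym (ℚₚ.+-identityˡ (energyℚ u))
energyℚ-prepend (suc k) x u = trans
  (cong (ℚ.∣ x ∣ ℚ.+_) (energyℚ-prepend k x u))
  (sym (ℚₚ.+-assoc ℚ.∣ x ∣ (k · ℚ.∣ x ∣) (energyℚ u)))

energyℚ-replicate : ∀ k x → energyℚ (replicate k x) ≡ k · ℚ.∣ x ∣
energyℚ-replicate zero    x = refl
energyℚ-replicate (suc k) x = cong (ℚ.∣ x ∣ ℚ.+_) (energyℚ-replicate k x)

·-nonNeg : ∀ k → 0ℚ ℚ.≤ k · 2ℚ
·-nonNeg zero    = ℚₚ.≤-refl
·-nonNeg (suc k) = ℚₚ.+-mono-≤ (ℚₚ.nonNegative⁻¹ 2ℚ) (·-nonNeg k)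

·-mono-< : ∀ {k l} → k < l → k · 2ℚ ℚ.< l · 2ℚ
·-mono-< {zero}  {suc l} _         = ℚₚ.+-mono-<-≤ (ℚₚ.positive⁻¹ 2ℚ) (·-nonNeg l)
·-mono-< {suc k} {suc l} (s≤s k<l) = ℚₚ.+-monoʳ-< 2ℚ (·-mono-< k<l)

-- The left-hand side has the shape in which det-block delivers the eigenvalue.
shifted-eigenvalue : ∀ q a → (q ℚ.+ 2ℚ) ℚ.+ suc a · -2ℚ ≡ q ℚ.- a · 2ℚ
shifted-eigenvalue q zero    =
  solve 1 (λ q → (q :+ con 2ℚ) :+ (con -2ℚ :+ con 0ℚ) := q :- con 0ℚ) refl q
shifted-eigenvalue q (suc a) = begin
  (q ℚ.+ 2ℚ) ℚ.+ (-2ℚ ℚ.+ suc a · -2ℚ)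
    ≡⟨ solve 2 (λ q s → (q :+ con 2ℚ) :+ (con -2ℚ :+ s) := ((q :+ con 2ℚ) :+ s) :- con 2ℚ) refl
         q (suc a · -2ℚ) ⟩
  ((q ℚ.+ 2ℚ) ℚ.+ suc a · -2ℚ) ℚ.- 2ℚ
    ≡⟨ cong (ℚ._- 2ℚ) (shifted-eigenvalue q a) ⟩
  (q ℚ.- a · 2ℚ) ℚ.- 2ℚ
    ≡⟨ solve 2 (λ q s → (q :- s) :- con 2ℚ := q :- (con 2ℚ :+ s)) refl q (a · 2ℚ) ⟩
  q ℚ.- suc a · 2ℚ ∎

charPolyℚ-spectrum : ∀ q a b → charPolyℚ q (spectrum a b) ≡
  (q ℚ.- a · 2ℚ) ℚ.* ((q ℚ.+ 2ℚ) ^ a ℚ.* ((q ℚ.- b · 2ℚ) ℚ.* (q ℚ.+ 2ℚ) ^ b))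
charPolyℚ-spectrum q a b = cong ((q ℚ.- a · 2ℚ) ℚ.*_) (trans
  (charPolyℚ-prepend q a -2ℚ ((b · 2ℚ) Vector.∷ replicate b -2ℚ))
  (cong (λ p → (q ℚ.+ 2ℚ) ^ a ℚ.* ((q ℚ.- b · 2ℚ) ℚ.* p)) (charPolyℚ-replicate q b -2ℚ)))

-- In each block the positive eigenvalue balances the copies of -2, so only `a + b` matters.
energyℚ-spectrum : ∀ a b →
  energyℚ (spectrum a b) ≡ (a +ℕ b) · 2ℚ ℚ.+ (a +ℕ b) · 2ℚ
energyℚ-spectrum a b = begin
  ℚ.∣ p ∣ ℚ.+ energyℚ (prepend a -2ℚ ((b · 2ℚ) Vector.∷ replicate b -2ℚ))
    -- `ℚ.∣ -2ℚ ∣` computes to `2ℚ`, so the `a` copies of -2 contribute `p` again.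
    ≡⟨ cong (ℚ.∣ p ∣ ℚ.+_) (energyℚ-prepend a -2ℚ ((b · 2ℚ) Vector.∷ replicate b -2ℚ)) ⟩
  ℚ.∣ p ∣ ℚ.+ (p ℚ.+ (ℚ.∣ r ∣ ℚ.+ energyℚ (replicate b -2ℚ)))
    ≡⟨ cong₂ (λ s t → s ℚ.+ (p ℚ.+ t)) (ℚₚ.0≤p⇒∣p∣≡p (·-nonNeg a))
         (cong₂ ℚ._+_ (ℚₚ.0≤p⇒∣p∣≡p (·-nonNeg b)) (energyℚ-replicate b -2ℚ)) ⟩
  p ℚ.+ (p ℚ.+ (r ℚ.+ r))
    ≡⟨ solve 2 (λ p r → p :+ (p :+ (r :+ r)) := (p :+ r) :+ (p :+ r)) refl p r ⟩
  (p ℚ.+ r) ℚ.+ (p ℚ.+ r)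
    ≡⟨ cong (λ s → s ℚ.+ s) (·-homo-+ 2ℚ a b) ⟨
  (a +ℕ b) · 2ℚ ℚ.+ (a +ℕ b) · 2ℚ ∎
  where
  p r : ℚ
  p = a · 2ℚ
  r = b · 2ℚ

constant-block : ∀ b → Block b (firstPart {suc b} 0) (firstPart {0} 0)
constant-block zero    = last λ ()
constant-block (suc b) = more refl (constant-block b)

firstPart-block : ∀ a b → Block a (firstPart {suc a +ℕ b} (suc a)) (firstPart {b} 0)
firstPart-block zero    b = last λ _ ()
firstPart-block (suc a) b = more refl (firstPart-block a b)

firstPart-det : ∀ q a b →
  detℚ (BlockDet.blocks -2ℚ (q ℚ.+ 2ℚ) (q ℚ.+ 2ℚ) (firstPart {suc a +ℕ suc b} (suc a))) ≡
  charPolyℚ q (spectrum a b)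
firstPart-det q a b = begin
  detℚ (blocks y (firstPart {suc a +ℕ suc b} (suc a)))
    ≡⟨ det-block (firstPart-block a (suc b)) ⟩
  (y ℚ.+ suc a · -2ℚ) ℚ.* y ^ a ℚ.* detℚ (blocks y (firstPart {suc b} 0))
    ≡⟨ cong ((y ℚ.+ suc a · -2ℚ) ℚ.* y ^ a ℚ.*_) (det-block (constant-block b)) ⟩
  (y ℚ.+ suc a · -2ℚ) ℚ.* y ^ a ℚ.* ((y ℚ.+ suc b · -2ℚ) ℚ.* y ^ b ℚ.* 1ℚ)
    ≡⟨ cong₂ (λ s t → s ℚ.* y ^ a ℚ.* (t ℚ.* y ^ b ℚ.* 1ℚ))
         (shifted-eigenvalue q a) (shifted-eigenvalue q b) ⟩
  (q ℚ.- a · 2ℚ) ℚ.* y ^ a ℚ.* ((q ℚ.- b · 2ℚ) ℚ.* y ^ b ℚ.* 1ℚ)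
    ≡⟨ solve 4 (λ s p t r → s :* p :* (t :* r :* con 1ℚ) := s :* (p :* (t :* r))) refl
         (q ℚ.- a · 2ℚ) (y ^ a) (q ℚ.- b · 2ℚ) (y ^ b) ⟩
  (q ℚ.- a · 2ℚ) ℚ.* (y ^ a ℚ.* ((q ℚ.- b · 2ℚ) ℚ.* y ^ b))
    ≡⟨ charPolyℚ-spectrum q a b ⟨
  charPolyℚ q (spectrum a b) ∎
  where
  y = q ℚ.+ 2ℚ
  open BlockDet -2ℚ y

-- Complete bipartite graphs with parts of given sizes

-- The number n of vertices is a variable, with an equation for its value:
-- otherwise det unfolds during conversion checking.
Parts : ℕ → ℕ → ℕ → Set
Parts a b n = (2 +ℕ a) +ℕ (2 +ℕ b) ≡ n

partEigenvalues : ∀ a b → Parts a b n → Vector ℚ n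
partEigenvalues a b refl = spectrum (suc a) (suc b)

mate : ∀ a b → Parts a b n → (u : Fin n) →
  ∃[ v ] v ≢ u × firstPart (2 +ℕ a) u ≡ firstPart (2 +ℕ a) v
mate a b refl u with firstPart (2 +ℕ a) u in eq
... | true with firstPart-true (2 +ℕ a) (2 +ℕ b) u eq
-- The part has at least two vertices, so `punchIn j zero` is an index in it other than `j`.
...   | j , refl = punchIn j zero ↑ˡ (2 +ℕ b) ,
  punchInᵢ≢i j zero ∘ ↑ˡ-injective (2 +ℕ b) _ _ ,
  sym (firstPart-↑ˡ (2 +ℕ a) (2 +ℕ b) (punchIn j zero))
mate a b refl u | false with firstPart-false (2 +ℕ a) {2 +ℕ b} u eq
...   | j , refl = (2 +ℕ a) ↑ʳ punchIn j zero ,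
  punchInᵢ≢i j zero ∘ ↑ʳ-injective (2 +ℕ a) _ _ ,
  sym (firstPart-↑ʳ (2 +ℕ a) (punchIn j zero))

opposite : ∀ a b → Parts a b n → (u : Fin n) →
  Σ[ v ∈ Fin n ] firstPart (2 +ℕ a) u ≢ firstPart (2 +ℕ a) v
opposite a b refl u with firstPart (2 +ℕ a) u
... | true  = (2 +ℕ a) ↑ʳ zero {suc b} , λ p →
  contradiction (trans p (firstPart-↑ʳ (2 +ℕ a) {2 +ℕ b} zero)) λ ()
... | false = zero , λ ()

-- The parts have `2 +ℕ a` and `2 +ℕ b` vertices; the offset guarantees a mate for every vertex.
K : ∀ a b → Parts a b n → Graph n
K a b eq = CompleteBipartite.graph (firstPart (2 +ℕ a)) (mate a b eq) (opposite a b eq)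

det-partEigenvalues : ∀ q a b (eq : Parts a b n) →
  detℚ (BlockDet.blocks -2ℚ (q ℚ.+ 2ℚ) (q ℚ.+ 2ℚ) (firstPart {n} (2 +ℕ a))) ≡
  charPolyℚ q (partEigenvalues a b eq)
det-partEigenvalues q a b refl = firstPart-det q (suc a) (suc b)

K-charPoly : ∀ a b (eq : Parts a b n) x k →
  seq (charPoly (ε (K a b eq)) x) k ≡ charPolyℚ (seq x k) (partEigenvalues a b eq)
K-charPoly a b eq x k = trans
  (CompleteBipartite.seq-charPoly (firstPart (2 +ℕ a)) (mate a b eq) (opposite a b eq) x k)
  (det-partEigenvalues (seq x k) a b eq)

K-isSpectrum : ∀ a b (eq : Parts a b n) → IsSpectrum (ε (K a b eq)) (fromℚ ∘ partEigenvalues a b eq)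
K-isSpectrum a b eq x =
  ≗⇒≈ (charPoly (ε (K a b eq)) x) (∏ λ i → x - fromℚ (partEigenvalues a b eq i)) λ k →
    trans (K-charPoly a b eq x k)
      (sym (seq-foldr k _*_ ℚ._*_ 1ℝ (λ _ _ → refl) (λ i → x - fromℚ (partEigenvalues a b eq i))))

-- The number `4(n - 2)`, in the form in which the sum over the spectrum delivers it.
energy : ℕ → ℚ
energy n = (n ∸ 2) · 2ℚ ℚ.+ (n ∸ 2) · 2ℚ

energyℚ-partEigenvalues : ∀ a b (eq : Parts a b n) → energyℚ (partEigenvalues a b eq) ≡ energy n
energyℚ-partEigenvalues a b refl = trans (energyℚ-spectrum (suc a) (suc b))
  (cong (λ k → k · 2ℚ ℚ.+ k · 2ℚ) (sym (ℕₚ.+-suc a (suc b))))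

K-energy : ∀ a b (eq : Parts a b n) → HasEnergy (K a b eq) (fromℚ (energy n))
K-energy {n} a b eq = fromℚ ∘ partEigenvalues a b eq , K-isSpectrum a b eq ,
  ≗⇒≈ (fromℚ (energy n)) (∑ λ i → ∣ fromℚ (partEigenvalues a b eq i) ∣) λ k → trans
    (sym (energyℚ-partEigenvalues a b eq))
    (sym (seq-foldr k _+_ ℚ._+_ 0ℝ (λ _ _ → refl) (λ i → ∣ fromℚ (partEigenvalues a b eq i) ∣)))

K-independentSet : ∀ a b (eq : Parts a b n) → IndependentSet (K a b eq) (2 +ℕ b)
K-independentSet a b refl = (2 +ℕ a) ↑ʳ_ , ↑ʳ-injective (2 +ℕ a) _ _ , λ i j e →
  e (trans (firstPart-↑ʳ (2 +ℕ a) i) (sym (firstPart-↑ʳ (2 +ℕ a) j)))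

-- Non-adjacent vertices share a side, so the whole set lies in the part of its first vertex.
K-independentSet-≤ : ∀ a b k (eq : Parts a b n) →
  IndependentSet (K a b eq) (suc k) → suc k ≤ 2 +ℕ a ⊎ suc k ≤ 2 +ℕ b
K-independentSet-≤ a b k refl (f , f-inj , f-indep) with firstPart (2 +ℕ a) (f zero) in eq
... | true  = inj₁ (injective⇒≤ {f = proj₁ ∘ g} λ {i} {j} p →
  f-inj (trans (sym (proj₂ (g i))) (trans (cong (_↑ˡ (2 +ℕ b)) p) (proj₂ (g j)))))
  where
  g : ∀ i → ∃[ j ] j ↑ˡ (2 +ℕ b) ≡ f i
  g i = firstPart-true (2 +ℕ a) (2 +ℕ b) (f i)
    -- Non-adjacency is a doubly negated equality of sides, and equality of Booleans is decidable.
    (trans (decidable-stable (_ Boolₚ.≟ _) (f-indep i zero)) eq)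
... | false = inj₂ (injective⇒≤ {f = proj₁ ∘ g} λ {i} {j} p →
  f-inj (trans (sym (proj₂ (g i))) (trans (cong ((2 +ℕ a) ↑ʳ_) p) (proj₂ (g j)))))
  where
  g : ∀ i → ∃[ j ] (2 +ℕ a) ↑ʳ j ≡ f i
  g i = firstPart-false (2 +ℕ a) (f i)
    (trans (decidable-stable (_ Boolₚ.≟ _) (f-indep i zero)) eq)

-- Separating the graphs

charPolyℚ-root : ∀ a b → charPolyℚ (b · 2ℚ) (spectrum a b) ≡ 0ℚ
charPolyℚ-root a b = trans (charPolyℚ-spectrum q a b) (trans
  (cong (λ s → (q ℚ.- a · 2ℚ) ℚ.* ((q ℚ.+ 2ℚ) ^ a ℚ.* (s ℚ.* (q ℚ.+ 2ℚ) ^ b)))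
    (ℚₚ.+-inverseʳ q))
  (solve 3 (λ s p r → s :* (p :* (con 0ℚ :* r)) := con 0ℚ) refl
    (q ℚ.- a · 2ℚ) ((q ℚ.+ 2ℚ) ^ a) ((q ℚ.+ 2ℚ) ^ b)))
  where
  q = b · 2ℚ

*-positive : ∀ {p q} → 0ℚ ℚ.< p → 0ℚ ℚ.< q → 0ℚ ℚ.< p ℚ.* q
*-positive {p} {q} 0<p 0<q =
  ℚₚ.positive⁻¹ (p ℚ.* q) {{ℚₚ.pos*pos⇒pos p {{ℚ.positive 0<p}} q {{ℚ.positive 0<q}}}}

^-positive : ∀ {p} k → 0ℚ ℚ.< p → 0ℚ ℚ.< p ^ k
^-positive zero    0<p = ℚₚ.positive⁻¹ 1ℚ
^-positive (suc k) 0<p = *-positive 0<p (^-positive k 0<p)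

-- All roots `2a`, `2b` and -2 lie below `2k`, so every factor is positive.
charPolyℚ-positive : ∀ {a b k} → a < k → b < k → 0ℚ ℚ.< charPolyℚ (k · 2ℚ) (spectrum a b)
charPolyℚ-positive {a} {b} {k} a<k b<k =
  subst (0ℚ ℚ.<_) (sym (charPolyℚ-spectrum (k · 2ℚ) a b))
    (*-positive (gap a<k) (*-positive (^-positive a y>0)
      (*-positive (gap b<k) (^-positive b y>0))))
  where
  gap : ∀ {l} → l < k → 0ℚ ℚ.< k · 2ℚ ℚ.- l · 2ℚ
  gap {l} l<k = subst (ℚ._< k · 2ℚ ℚ.- l · 2ℚ) (ℚₚ.+-inverseʳ (l · 2ℚ))
    (ℚₚ.+-monoˡ-< (ℚ.- (l · 2ℚ)) (·-mono-< l<k))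
  y>0 : 0ℚ ℚ.< k · 2ℚ ℚ.+ 2ℚ
  y>0 = ℚₚ.+-mono-≤-< (·-nonNeg k) (ℚₚ.positive⁻¹ 2ℚ)


partEigenvalues-root : ∀ a b (eq : Parts a b n) →
  charPolyℚ (suc b · 2ℚ) (partEigenvalues a b eq) ≡ 0ℚ
partEigenvalues-root a b refl = charPolyℚ-root (suc a) (suc b)

partEigenvalues-positive : ∀ a b k (eq : Parts a b n) → a < k → b < k →
  0ℚ ℚ.< charPolyℚ (suc k · 2ℚ) (partEigenvalues a b eq)
partEigenvalues-positive a b k refl a<k b<k = charPolyℚ-positive (s≤s a<k) (s≤s b<k)

-- The part of size `2 +ℕ b` is larger than both parts of the second graph. It is an independent set
-- too large for that graph, and its eigenvalue `2(b + 1)` exceeds all eigenvalues there.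
K-nonCospectral : ∀ a b a′ b′ (eq : Parts a b n) (eq′ : Parts a′ b′ n) →
  a′ < b → b′ < b → NonCospectral (K a b eq) (K a′ b′ eq′)
K-nonCospectral {n} a b a′ b′ eq eq′ a′<b b′<b = non-isomorphic , different-spectrum
  where
  non-isomorphic : ¬ K a b eq ≅ K a′ b′ eq′
  non-isomorphic iso with K-independentSet-≤ a′ b′ (suc b) eq′
    (≅-independentSet {G = K a b eq} {K a′ b′ eq′} iso (K-independentSet a b eq))
  ... | inj₁ (s≤s (s≤s b≤a′)) = ℕₚ.<⇒≱ a′<b b≤a′
  ... | inj₂ (s≤s (s≤s b≤b′)) = ℕₚ.<⇒≱ b′<b b≤b′
  different-spectrum : ¬ SameSpectrum (K a b eq) (K a′ b′ eq′)
  -- At `x`, the product over a common list `ev` would equal both 0 and a positive rational.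
  different-spectrum (ev , isSpec , isSpec′) = 0≉positive
    {charPoly (ε (K a b eq)) x} {charPoly (ε (K a′ b′ eq′)) x} {∏ λ i → x - ev i}
    (λ k → trans (K-charPoly a b eq x k) (partEigenvalues-root a b eq))
    (K-charPoly a′ b′ eq′ x)
    (partEigenvalues-positive a′ b′ b eq′ a′<b b′<b)
    (isSpec x) (isSpec′ x)
    where
    x = fromℚ (suc b · 2ℚ)

parts : ∀ {c a} → 4 +ℕ c ≡ n → a ≤ c → Parts a (c ∸ a) n
parts {c = c} {a} refl a≤c = cong (2 +ℕ_) (trans (ℕₚ.+-suc a (suc (c ∸ a)))
  (cong suc (trans (ℕₚ.+-suc a (c ∸ a)) (cong suc (ℕₚ.m+[n∸m]≡n a≤c)))))

-- The hypothesis on c makes 2 + (c ∸ a) the larger part of the graphs considered.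
module Family {n} (c : ℕ) (eq : 4 +ℕ c ≡ n) (6<c : 6 < c) where

  private
    ≤c : ∀ {a} → a ≤ 3 → a ≤ c
    ≤c a≤3 = ℕₚ.≤-trans a≤3 (ℕₚ.≤-trans (ℕₚ.m≤m+n 3 4) 6<c)

  G : ∀ a → a ≤ 3 → Graph n
  G a a≤3 = K a (c ∸ a) (parts eq (≤c a≤3))

  G-<-nonCospectral : ∀ {a b} (a≤3 : a ≤ 3) (b≤3 : b ≤ 3) → a < b →
    NonCospectral (G a a≤3) (G b b≤3)
  G-<-nonCospectral {a} {b} a≤3 b≤3 a<b =
    K-nonCospectral a (c ∸ a) b (c ∸ b) (parts eq (≤c a≤3)) (parts eq (≤c b≤3))
      -- The chain is `b ≤ 3 < c ∸ 3 ≤ c ∸ a`.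
      (ℕₚ.≤-<-trans b≤3 (ℕₚ.<-≤-trans (ℕₚ.∸-monoˡ-≤ 3 6<c) (ℕₚ.∸-monoʳ-≤ c a≤3)))
      (ℕₚ.∸-monoʳ-< a<b (≤c b≤3))

  G-nonCospectral : ∀ {a b} (a≤3 : a ≤ 3) (b≤3 : b ≤ 3) → a ≢ b →
    NonCospectral (G a a≤3) (G b b≤3)
  G-nonCospectral {a} {b} a≤3 b≤3 a≢b = compare (ℕₚ.<-cmp a b)
    where
    compare : Tri (a < b) (a ≡ b) (b < a) → NonCospectral (G a a≤3) (G b b≤3)
    compare (tri< a<b _ _) = G-<-nonCospectral a≤3 b≤3 a<b
    compare (tri≈ _ a≡b _) = contradiction a≡b a≢b
    compare (tri> _ _ b<a) =
      NonCospectral-sym {G = G b b≤3} {G a a≤3} (G-<-nonCospectral b≤3 a≤3 b<a)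

  toℕ≤2 : (i : Fin 3) → toℕ i ≤ 2
  toℕ≤2 i = ℕₚ.≤-pred (toℕ<n i)

  bound : ∀ s → s ≤ 1 → (i : Fin 3) → s +ℕ toℕ i ≤ 3
  bound s s≤1 i = ℕₚ.+-mono-≤ s≤1 (toℕ≤2 i)

  -- Three consecutive members of the family; the choices 0 and 1 of `s` give triplets overlapping
  -- in two graphs.
  triplet : ∀ s → s ≤ 1 → Fin 3 → Graph n
  triplet s s≤1 i = G (s +ℕ toℕ i) (bound s s≤1 i)

  triplet-isTriplet : ∀ s (s≤1 : s ≤ 1) → IsTriplet (triplet s s≤1)
  triplet-isTriplet s s≤1 {i} {j} i≢j =
    G-nonCospectral (bound s s≤1 i) (bound s s≤1 j) (i≢j ∘ toℕ-injective ∘ ℕₚ.+-cancelˡ-≡ s _ _) ,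
    fromℚ (energy n) , has-energy i , has-energy j
    where
    has-energy : ∀ i → HasEnergy (triplet s s≤1 i) (fromℚ (energy n))
    has-energy i = K-energy (s +ℕ toℕ i) (c ∸ (s +ℕ toℕ i)) (parts eq (≤c (bound s s≤1 i)))

  -- The graph with a part of size 2 opens the first triplet, while the smaller parts in the second
  -- have 3, 4 or 5 vertices.
  triplets-differ : ¬ SameTriplet (triplet 0 z≤n) (triplet 1 (s≤s z≤n))
  triplets-differ (π , iso) = proj₁
    (G-nonCospectral (bound 0 z≤n zero) (bound 1 (s≤s z≤n) (π ⟨$⟩ʳ zero)) λ ())
    (iso zero)

  triplets : Σ[ S ∈ (Fin 3 → Graph n) ] Σ[ T ∈ (Fin 3 → Graph n) ]
    (IsTriplet S × IsTriplet T × ¬ SameTriplet S T)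
  triplets = triplet 0 z≤n , triplet 1 (s≤s z≤n) ,
    triplet-isTriplet 0 z≤n , triplet-isTriplet 1 (s≤s z≤n) , triplets-differ

corollary5p7 : ∀ (t : ℕ) → 3 ≤ t → Σ[ S ∈ (Fin 3 → Graph (6 +ℕ 12 *ℕ t)) ] Σ[ T ∈ (Fin 3 → Graph (6 +ℕ 12 *ℕ t)) ]
    (IsTriplet S × IsTriplet T × ¬ SameTriplet S T)
corollary5p7 t 3≤t = Family.triplets {6 +ℕ 12 *ℕ t} (2 +ℕ 12 *ℕ t) refl
  -- The bound `7 ≤ 2 + 12 t` follows from `5 ≤ 5 + 31 = 12 * 3 ≤ 12 t`.
  (ℕₚ.+-monoʳ-≤ 2 (ℕₚ.≤-trans (ℕₚ.m≤m+n 5 31) (ℕₚ.*-monoʳ-≤ 12 3≤t)))
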